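{- For every positive integer $k$ there exists a tree $T_k$ such that $|V(T_k)|=2^{O(k\log k)}$ and $h(T_k)\ge k$. (Here the implied constant in $O(\cdot)$ is absolute, i.e. there is a constant $C$ such that $|V(T_k)|\le 2^{Ck\log k}$ for all $k\ge2$.)
   Context: Hunters \& Rabbit game on a graph $G$ with $k$ hunters: a hunters' strategy is a sequence $\mathcal H=(H_1,H_2,\ldots)$ of sets $H_i\subseteq V(G)$ with $|H_i|\le k$. A rabbit's strategy is a sequence $(r_0,r_1,\ldots)$ of vertices with $r_i$ adjacent to $r_{i-1}$ for all $i\ge1$. $\mathcal H$ is winning if for every rabbit's strategy there is $i\ge1$ with $r_{i-1}\in H_i$. The hunter number $h(G)$ is the minimum $k$ such that $k$ hunters have a winning strategy on $G$. -}

module Defs where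

open import Level using (0ℓ)
open import Data.Nat using (ℕ; suc; _≤_; _<_)
open import Data.Fin using (Fin)
open import Data.Fin.Subset using (Subset; _∈_; ∣_∣)
open import Data.List using (List; []; _∷_; length)
open import Data.List.Relation.Unary.Unique.Propositional using (Unique)
open import Data.Product using (Σ; _×_; ∃)
open import Relation.Nullary using (¬_)
open import Relation.Binary.PropositionalEquality using (_≡_)

record Graph (n : ℕ) : Set₁ where
  field
    Adj     : Fin n → Fin n → Set
    sym     : ∀ {u v} → Adj u v → Adj v u
    irrefl  : ∀ {u} → ¬ Adj u u

open Graph public

data Walk {n : ℕ} (G : Graph n) : Fin n → Fin n → Set where
  here : ∀ {u} → Walk G u u
  step : ∀ {u v w} → Adj G u v → Walk G v w → Walk G u w

Connected : ∀ {n} → Graph n → Set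
Connected G = ∀ u v → Walk G u v

PathList : ∀ {n} → Graph n → Fin n → List (Fin n) → Fin n → Set
PathList G u []       w = u ≡ w
PathList G u (v ∷ vs) w = Adj G u v × PathList G v vs w

HasCycle : ∀ {n} → Graph n → Set
HasCycle {n} G =
  Σ (Fin n) λ v₀ → Σ (List (Fin n)) λ vs → Σ (Fin n) λ vₘ →
    (2 ≤ length vs) × Unique (v₀ ∷ vs) × PathList G v₀ vs vₘ × Adj G vₘ v₀

IsTree : ∀ {n} → Graph n → Set
IsTree {n} G = 1 ≤ n × Connected G × ¬ HasCycle G

-- Hunters' strategy with k hunters: H i stands for H_{i+1} (i.e. H 0 = H₁),
-- each of size at most k.
HunterStrategy : ℕ → ℕ → Set
HunterStrategy n k = Σ (ℕ → Subset n) λ H → ∀ i → ∣ H i ∣ ≤ k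

IsRabbitStrategy : ∀ {n} → Graph n → (ℕ → Fin n) → Set
IsRabbitStrategy G r = ∀ i → Adj G (r i) (r (suc i))

-- Winning: every rabbit strategy is caught, i.e. ∃ i ≥ 1 with r_{i-1} ∈ H_i;
-- with the shifted indexing this is r i ∈ H i.
IsWinning : ∀ {n} → Graph n → (ℕ → Subset n) → Set
IsWinning {n} G H = ∀ (r : ℕ → Fin n) → IsRabbitStrategy G r → ∃ λ i → r i ∈ H i

HuntersWin : ∀ {n} → Graph n → ℕ → Set
HuntersWin {n} G k = Σ (HunterStrategy n k) λ S → IsWinning G (Data.Product.proj₁ S)

-- h(G) ≥ k : no j < k admits a winning strategy with j hunters
-- (h(G) is the minimum k for which k hunters win).
HunterNumber≥ : ∀ {n} → Graph n → ℕ → Set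
HunterNumber≥ G k = ∀ j → j < k → ¬ HuntersWin G j

{-# OPTIONS --safe #-}

-- The tree is the complete d-ary tree of height D = 2k − 1 with d of order k².
-- Follow one parity class of the rabbit, against p hunters at the times when the
-- class can occupy the root and q hunters at the other times.  If p + q < D then
-- the class is never wiped out, by induction on D.  In a child subtree the roles
-- of p and q are exchanged, and the induction hypothesis applies to it unless at
-- some time all p hunters shoot inside that single subtree.  The root is then not
-- shot; it is contaminated, because some other child subtree has been left alone
-- both long enough after the last reset to have been filled and long enough before
-- the present to fill again and reach the root.  So every child subtree is reseeded
-- from the root, which is a new reset.
--
-- This yields arbitrarily long evading walks.  An infinite one would follow by
-- Kőnig's lemma; constructively, the bounded number of positions at each time
-- replaces it: a strategy that catches every infinite walk does so within a
-- uniform time.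

module Submission where

open import Defs hiding (sym)
open import Data.Bool using (Bool; true; false; not; if_then_else_)
open import Data.Bool.Properties using (not-involutive)
open import Data.Fin using (Fin; zero; suc; combine; remQuot)
open import Data.Fin.Properties
  using (any?; injective⇒≤; remQuot-combine; combine-remQuot) renaming (_≟_ to _≟ᶠ_)
open import Data.Fin.Subset using (Subset; ∣_∣) renaming (_∈_ to _∈ˢ_)
open import Data.Fin.Subset.Properties using () renaming (_∈?_ to _∈ˢ?_)
open import Data.List using (List; []; _∷_; length; _++_; lookup; map; allFin)
open import Data.List.Membership.Propositional using (_∈_; _∉_)
open import Data.List.Membership.Propositional.Properties
  using (∈-++⁺ˡ; ∈-++⁺ʳ; ∈-map⁺; ∈-allFin; ∈-lookup)
open import Data.List.Properties using (length-++; length-map)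
open import Data.List.Relation.Unary.All as All using (All; []; _∷_)
open import Data.List.Relation.Unary.AllPairs using ([]; _∷_)
open import Data.List.Relation.Unary.Any as Any using (here; there; index)
open import Data.List.Relation.Unary.Any.Properties using (lookup-index)
open import Data.List.Relation.Unary.Unique.Propositional using (Unique)
open import Data.Nat
  using (ℕ; zero; suc; _+_; _*_; _∸_; _^_; _⊔_; _≤_; _<_; z≤n; s≤s; s≤s⁻¹; _≤?_; _<?_)
open import Data.Nat.Logarithm using (⌊log₂_⌋; ⌊log₂⌋-mono-≤; ⌊log₂[2^n]⌋≡n)
open import Data.Nat.Properties hiding (_≟_; _≤?_; _<?_)
open import Data.Nat.Solver using (module +-*-Solver)
open import Data.Product using (Σ; ∃; ∃-syntax; _×_; _,_; proj₁; proj₂)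
open import Data.Sum using (_⊎_; inj₁; inj₂; swap)
open import Data.Unit using (⊤; tt)
open import Data.Vec using ([]; _∷_; there)
open import Function using (_∘_)
open import Relation.Nullary using (¬_; Dec; yes; no; contradiction)
open import Relation.Nullary.Decidable using (_×-dec_; _⊎-dec_; ¬?; map′; decidable-stable)
open import Relation.Binary.PropositionalEquality
  using (_≡_; _≢_; refl; sym; trans; cong; subst; subst₂)

-- Complete trees and unhindered motion of the rabbit.

data Tree (d : ℕ) : ℕ → Set where
  root : ∀ {D} → Tree d D
  sub  : ∀ {D} → Fin d → Tree d D → Tree d (suc D)

private
  variable
    d D : ℕ

data Child {d} : Tree d D → Tree d D → Set where
  top   : ∀ {i} → Child {D = suc D} root (sub i root)
  inner : ∀ {i} {x y : Tree d D} → Child x y → Child (sub i x) (sub i y)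

Adjacent : Tree d D → Tree d D → Set
Adjacent x y = Child x y ⊎ Child y x

within : ∀ {i} {x y : Tree d D} → Adjacent x y → Adjacent (sub i x) (sub i y)
within (inj₁ c) = inj₁ (inner c)
within (inj₂ c) = inj₂ (inner c)

depth : Tree d D → ℕ
depth root      = 0
depth (sub _ x) = suc (depth x)

depth≤ : (x : Tree d D) → depth x ≤ D
depth≤ root      = z≤n
depth≤ (sub _ x) = s≤s (depth≤ x)

-- C t x is read as: the rabbit may be at x at time t, before the shots of time t.
Family : ℕ → ℕ → Set₁
Family d D = ℕ → Tree d D → Set

below : Fin d → Family d (suc D) → Family d D
below i C t x = C t (sub i x)

Free : Family d D → ℕ → ℕ → Set
Free C a e = ∀ {s x y} → a ≤ s → s < e → C s x → Adjacent x y → C (suc s) y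

free-below : ∀ {C : Family d (suc D)} {a e i} → Free C a e → Free (below i C) a e
free-below free a≤s s<e c adj = free a≤s s<e c (within adj)

climb : ∀ {C : Family d D} {a e s} → Free C a e → a ≤ s →
  (x : Tree d D) → depth x + s ≤ e → C s x → C (depth x + s) root
climb free a≤s root _ c = c
climb {C = C} {s = s} free a≤s (sub i x) le c =
  free (≤-trans a≤s (m≤n+m s (depth x))) le
    (climb {C = below i C} (free-below {C = C} free) a≤s x (<⇒≤ le) c) (inj₂ top)

descend : ∀ {C : Family d D} {a e s} → Free C a e → a ≤ s →
  (x : Tree d D) → depth x + s ≤ e → C s root → C (depth x + s) x
descend free a≤s root _ c = c
descend {C = C} {e = e} {s = s} free a≤s (sub i x) le c =
  subst (λ t → C t (sub i x)) (+-suc (depth x) s)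
    (descend {C = below i C} (free-below {C = C} free) (m≤n⇒m≤1+n a≤s) x
      (subst (_≤ e) (sym (+-suc (depth x) s)) le)
      (free a≤s (≤-trans (s≤s (m≤n+m s (depth x))) le) c (inj₁ top)))

oscillate : ∀ {C : Family d (suc D)} {a e s} → Fin d → Free C a e → a ≤ s →
  ∀ m → m + m + s ≤ e → C s root → C (m + m + s) root
oscillate i free a≤s zero _ c = c
oscillate {C = C} {a} {e} {s} i free a≤s (suc m) le c =
  subst (λ g → C (suc g + s) root) (sym (+-suc m m))
    (free (m≤n⇒m≤1+n a≤now) now
      (free a≤now (<⇒≤ now) (oscillate {C = C} i free a≤s m (<⇒≤ (<⇒≤ now)) c) (inj₁ (top {i = i})))
      (inj₂ top))
  where
  a≤now : a ≤ m + m + s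
  a≤now = ≤-trans a≤s (m≤n+m s (m + m))
  now : suc (m + m + s) < e
  now = subst (λ g → suc g + s ≤ e) (+-suc m m) le

-- Parity classes of positions.

Phase : Set
Phase = ℕ → Bool

Alternating : Phase → Set
Alternating φ = ∀ t → φ (suc t) ≡ not (φ t)

alternating-not : ∀ {φ} → Alternating φ → Alternating (not ∘ φ)
alternating-not alt t = cong not (alt t)

-- The parity class of the root: the rabbit can be at the root only when φ t is
-- true, and the parity of the depth of its position alternates with t.
Active : Phase → ℕ → Tree d D → Set
Active φ t root      = φ t ≡ true
Active φ t (sub _ x) = Active (not ∘ φ) t x

not-false : ∀ {b} → b ≡ false → not b ≡ true
not-false refl = refl

active-climb : ∀ {φ s} → Alternating φ → (x : Tree d D) → Active φ s x → φ (depth x + s) ≡ true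
active-climb alt root act = act
active-climb {s = s} alt (sub _ x) act =
  trans (alt (depth x + s)) (active-climb (alternating-not alt) x act)

active-descend : ∀ {φ s} → Alternating φ → (x : Tree d D) → Active φ (depth x + s) x → φ s ≡ true
active-descend alt root act = act
active-descend {φ = φ} {s} alt (sub i x) act = trans (sym (not-involutive (φ s)))
  (trans (cong not (sym (alt s)))
    (active-descend (alternating-not alt) x
      (subst (λ t → Active (not ∘ φ) t x) (sym (+-suc (depth x) s)) act)))

even-gap : ∀ {φ} → Alternating φ → ∀ g s → φ s ≡ true → φ (g + s) ≡ true → ∃[ m ] g ≡ m + m
even-gap alt zero s _ _ = 0 , refl
even-gap {φ} alt (suc zero) s p q with φ s | alt s
even-gap alt (suc zero) s refl q | true | eq with trans (sym q) eq
... | ()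
even-gap {φ} alt (suc (suc g)) s p q
  with m , refl ← even-gap alt g s p
         (trans (sym (not-involutive (φ (g + s))))
           (trans (cong not (sym (alt (g + s)))) (trans (sym (alt (suc (g + s)))) q)))
  = suc m , cong suc (sym (+-suc m m))

m≤n⇒∃[o]o+m≡n : ∀ {m n} → m ≤ n → ∃[ o ] o + m ≡ n
m≤n⇒∃[o]o+m≡n {m} {n} m≤n = n ∸ m , m∸n+n≡m m≤n

-- After the climb the rabbit waits by shuttling between the root and a child. Both the arrival and
-- `u` are times when the class can occupy the root, so the wait is a whole number of round trips.
reach-root : ∀ {C : Family d (suc D)} {a e s u φ} → Fin d → Alternating φ → Free C a e → a ≤ s →
  (x : Tree d (suc D)) → Active φ s x → C s x → φ u ≡ true → depth x + s ≤ u → u ≤ e → C u root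
reach-root {C = C} {a} {e} {s} {u} {φ} i alt free a≤s x act c φu le u≤e
  with g , u≡ ← m≤n⇒∃[o]o+m≡n le
  with m , refl ← even-gap alt g (depth x + s) (active-climb alt x act) (trans (cong φ u≡) φu)
  = subst (λ t → C t root) u≡
      (oscillate {C = C} i free (≤-trans a≤s (m≤n+m s (depth x))) m (≤-trans (≤-reflexive u≡) u≤e)
        (climb {C = C} free a≤s x (≤-trans le u≤e) c))

-- The route climbs from `x`, waits at the root and leaves it `depth y` steps before `e`. The bound
-- on the depths leaves enough time; the two activity hypotheses give the wait the right parity.
spread : ∀ {C : Family d (suc D)} {a e s φ} → Fin d → Alternating φ → Free C a e → a ≤ s →
  (x y : Tree d (suc D)) → Active φ s x → C s x → Active φ e y →
  depth y + (depth x + s) ≤ e → C e y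
spread {C = C} {a} {e} {s} i alt free a≤s x y act c act′ le
  with u , refl ← m≤n⇒∃[o]m+o≡n (≤-trans (m≤m+n (depth y) (depth x + s)) le)
  = let le′ = +-cancelˡ-≤ (depth y) (depth x + s) u le in
    descend {C = C} free (≤-trans a≤s (≤-trans (m≤n+m s (depth x)) le′)) y ≤-refl
      (reach-root {C = C} i alt free a≤s x act c (active-descend alt y act′) le′ (m≤n+m u (depth y)))

neighbour : Fin d → (x : Tree d (suc D)) → ∃[ y ] Adjacent x y ×
  (∀ {φ t} → Alternating φ → Active φ t x → Active φ (suc t) y)
neighbour i root = sub i root , inj₁ top ,
  λ {φ} {t} alt act → trans (cong not (alt t)) (trans (not-involutive (φ t)) act)
neighbour i (sub j root) = root , inj₂ top , λ {_} {t} alt act → trans (alt t) act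
neighbour i (sub j (sub k x)) with y , adj , active ← neighbour i (sub k x)
  = sub j y , within adj , λ alt → active (alternating-not alt)

-- Unlike `spread`, this needs no minimal length of time: the position merely keeps moving.
stay : ∀ {C : Family d (suc D)} {a e s φ} → Fin d → Alternating φ → Free C a e → a ≤ s →
  ∀ g → g + s ≤ e → (∃[ x ] Active φ s x × C s x) → ∃[ x ] Active φ (g + s) x × C (g + s) x
stay i alt free a≤s zero _ h = h
stay {C = C} {s = s} i alt free a≤s (suc g) le h
  with x , act , c ← stay {C = C} i alt free a≤s g (<⇒≤ le) h
  with y , adj , active ← neighbour i x
  = y , active alt act , free (≤-trans a≤s (m≤n+m s g)) le c adj

-- Shots and the child subtrees they leave alone.

Shots : ℕ → ℕ → Set
Shots d D = ℕ → List (Tree d D)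

-- Only this inclusion is asked, so the property passes to a child subtree, where arrivals from the
-- root are ignored.
Closed : Family d D → Shots d D → Set
Closed C H = ∀ {s x y} → C s x → x ∉ H s → Adjacent x y → C (suc s) y

restrict : Fin d → List (Tree d (suc D)) → List (Tree d D)
restrict i []             = []
restrict i (root ∷ xs)    = restrict i xs
restrict i (sub j x ∷ xs) with i ≟ᶠ j
... | yes _ = x ∷ restrict i xs
... | no  _ = restrict i xs

restrict-∈ : ∀ {i} {x : Tree d D} {xs} → sub i x ∈ xs → x ∈ restrict i xs
restrict-∈ {xs = root ∷ xs} (there p) = restrict-∈ p
restrict-∈ {i = i} {xs = sub j y ∷ xs} p with i ≟ᶠ j
restrict-∈ (here refl) | yes _  = here refl
restrict-∈ (there p)   | yes _  = there (restrict-∈ p)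
restrict-∈ (here refl) | no i≢j = contradiction refl i≢j
restrict-∈ (there p)   | no _   = restrict-∈ p

length-restrict : ∀ i (xs : List (Tree d (suc D))) → length (restrict i xs) ≤ length xs
length-restrict i []             = z≤n
length-restrict i (root ∷ xs)    = m≤n⇒m≤1+n (length-restrict i xs)
length-restrict i (sub j x ∷ xs) with i ≟ᶠ j
... | yes _ = s≤s (length-restrict i xs)
... | no  _ = m≤n⇒m≤1+n (length-restrict i xs)

-- A shot at the root lies in no child subtree. This is why spending the whole budget inside one
-- subtree leaves the root unshot.
length-restrict-root : ∀ i {xs : List (Tree d (suc D))} → root ∈ xs →
  length (restrict i xs) < length xs
length-restrict-root i {root ∷ xs}    _         = s≤s (length-restrict i xs)
length-restrict-root i {sub j x ∷ xs} (there p) with i ≟ᶠ j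
... | yes _ = s≤s (length-restrict-root i p)
... | no  _ = m≤n⇒m≤1+n (length-restrict-root i p)

closed-below : ∀ {C : Family d (suc D)} {H i} → Closed C H → Closed (below i C) (restrict i ∘ H)
closed-below closed c x∉ adj = closed c (x∉ ∘ restrict-∈) (within adj)

Avoids : Fin d → List (Tree d (suc D)) → Set
Avoids i xs = ∀ x → sub i x ∉ xs

-- Pigeonhole: if every index occurred, its position in `xs` would inject `Fin d` into
-- `Fin (length xs)`.
avoiding-index : (xs : List (Fin d)) → length xs < d → ∃[ i ] i ∉ xs
avoiding-index {d} xs le with any? (λ i → ¬? (Any.any? (i ≟ᶠ_) xs))
... | yes h = h
... | no none = contradiction (injective⇒≤ inj) (<⇒≱ le)
  where
  mem : ∀ i → i ∈ xs
  mem i with Any.any? (i ≟ᶠ_) xs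
  ... | yes p = p
  ... | no ¬p = contradiction (i , ¬p) none
  inj : ∀ {i j} → index (mem i) ≡ index (mem j) → i ≡ j
  inj {i} {j} eq = trans (lookup-index (mem i)) (trans (cong (lookup xs) eq) (sym (lookup-index (mem j))))

branches : List (Tree d (suc D)) → List (Fin d)
branches []             = []
branches (root ∷ xs)    = branches xs
branches (sub i _ ∷ xs) = i ∷ branches xs

length-branches : (xs : List (Tree d (suc D))) → length (branches xs) ≤ length xs
length-branches []             = z≤n
length-branches (root ∷ xs)    = m≤n⇒m≤1+n (length-branches xs)
length-branches (sub _ _ ∷ xs) = s≤s (length-branches xs)

branches-∈ : ∀ {i x} {xs : List (Tree d (suc D))} → sub i x ∈ xs → i ∈ branches xs
branches-∈ (here refl) = here refl
branches-∈ {xs = root ∷ xs}    (there p) = branches-∈ p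
branches-∈ {xs = sub _ _ ∷ xs} (there p) = there (branches-∈ p)

avoiding : (xs : List (Tree d (suc D))) → length xs < d → ∃[ i ] Avoids i xs
avoiding xs le with i , i∉ ← avoiding-index (branches xs) (≤-<-trans (length-branches xs) le)
  = i , λ _ p → i∉ (branches-∈ p)

shots : Shots d D → ℕ → ℕ → List (Tree d D)
shots H a zero    = []
shots H a (suc w) = H a ++ shots H (suc a) w

length-shots : ∀ {H : Shots d D} {K} → (∀ s → length (H s) ≤ K) → ∀ a w → length (shots H a w) ≤ w * K
length-shots cap a zero = z≤n
length-shots {H = H} cap a (suc w) = ≤-trans (≤-reflexive (length-++ (H a)))
  (+-mono-≤ (cap a) (length-shots cap (suc a) w))

shots-∈ : ∀ {H : Shots d D} a w {s x} → a ≤ s → s < a + w → x ∈ H s → x ∈ shots H a w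
shots-∈ a zero a≤s s< x∈ = contradiction (≤-trans s< (≤-reflexive (+-identityʳ a))) (≤⇒≯ a≤s)
shots-∈ {H = H} a (suc w) {s} a≤s s< x∈ with m≤n⇒m<n∨m≡n a≤s
... | inj₂ refl = ∈-++⁺ˡ x∈
... | inj₁ a<s  = ∈-++⁺ʳ (H a)
      (shots-∈ (suc a) w a<s (≤-trans s< (≤-reflexive (+-suc a w))) x∈)

free-avoiding : ∀ {C : Family d (suc D)} {H i a w} → Closed C H → Avoids i (shots H a w) →
  Free (below i C) a (a + w)
free-avoiding {a = a} {w} closed av a≤s s< c adj = closed c (av _ ∘ shots-∈ a w a≤s s<) (within adj)

-- Survival of a parity class.

budget : Phase → ℕ → ℕ → ℕ → ℕ
budget φ p q s = if φ s then p else q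

root-budget : ∀ φ {p q s n} → φ s ≡ true → n ≤ budget φ p q s → n ≤ p
root-budget φ {s = s} eq le with φ s
root-budget φ refl le | true = le

other-budget : ∀ φ {p q s n} → φ s ≡ false → n ≤ budget φ p q s → n ≤ q
other-budget φ {s = s} eq le with φ s
other-budget φ refl le | false = le

module Survival (d K W : ℕ) (room : W * K + W * K < d) where

  -- `K` limits the shots at all times and serves to find subtrees left alone; the induction runs on
  -- `p` and `q`, which limit them from `t₀` until `t`. Phase, family and shots are quantified
  -- because the induction hypothesis is applied to child subtrees.
  Survives : ℕ → ℕ → ℕ → Set₁
  Survives D p q = ∀ {φ} → Alternating φ → ∀ {C : Family d D} {H} → Closed C H →
    (∀ s → length (H s) ≤ K) → ∀ {t₀ t} → t₀ ≤ t →
    (∀ s → t₀ ≤ s → s < t → length (H s) ≤ budget φ p q s) →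
    (∀ x → Active φ t₀ x → C t₀ x) → ∃[ x ] Active φ t x × C t x

  private
    some : Fin d
    some = proj₁ (avoiding-index [] (≤-<-trans z≤n room))

  -- `room` counts the shots of two windows of length `W`: one after the last reset, the other
  -- before the present.
  avoiding₂ : ∀ {D} {H : Shots d (suc D)} → (∀ s → length (H s) ≤ K) → ∀ a b →
    ∃[ i ] Avoids i (shots H a W) × Avoids i (shots H b W)
  avoiding₂ {H = H} cap a b
    with i , av ← avoiding (shots H a W ++ shots H b W)
           (≤-<-trans (≤-trans (≤-reflexive (length-++ (shots H a W)))
             (+-mono-≤ (length-shots cap a W) (length-shots cap b W))) room)
    = i , (λ x → av x ∘ ∈-++⁺ˡ) , (λ x → av x ∘ ∈-++⁺ʳ (shots H a W))

  module Step {D p q : ℕ} (wide : suc D + suc D ≤ W) (ih : Survives (suc D) q p)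
    {φ : Phase} (alt : Alternating φ) {C : Family d (suc (suc D))} {H : Shots d (suc (suc D))}
    (closed : Closed C H) (cap : ∀ s → length (H s) ≤ K) where

    Seeded : ℕ → Set
    Seeded t = ∀ i → ∃[ x ] Active φ t (sub i x) × C t (sub i x)

    -- Excludes the times at which all `suc p` shots fall into one child subtree, the only ones not
    -- covered by `ih`.
    Calm : ℕ → ℕ → Set
    Calm a e = ∀ s i → a ≤ s → s < e → φ s ≡ true → length (restrict i (H s)) ≤ p

    Budgeted : ℕ → ℕ → Set
    Budgeted a e = ∀ s → a ≤ s → s < e → length (H s) ≤ budget φ (suc p) q s

    -- Until `σ + W` the seed keeps moving, unhindered. By `σ + W` it has filled its parity class in
    -- the subtree, and from then on `ih` takes over.
    dirty : ∀ {σ t i} → Seeded σ → Avoids i (shots H σ W) → Calm (σ + W) t → Budgeted σ t →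
      ∀ u → σ ≤ u → u ≤ t → ∃[ x ] Active φ u (sub i x) × C u (sub i x)
    dirty {σ} {t} {i} seeded av calm bud u σ≤u u≤t with u ≤? σ + W
    ... | yes u≤ = subst (λ u → ∃[ x ] Active φ u (sub i x) × C u (sub i x)) (m∸n+n≡m σ≤u)
          (stay {C = below i C} i (alternating-not alt) (free-avoiding closed av) ≤-refl (u ∸ σ)
            (≤-trans (≤-reflexive (m∸n+n≡m σ≤u)) u≤) (seeded i))
    ... | no u≰ = ih (alternating-not alt) {below i C} {restrict i ∘ H} (closed-below {C = C} closed)
          (λ s → ≤-trans (length-restrict i (H s)) (cap s)) (<⇒≤ (≰⇒> u≰)) bud′ full
      where
      bud′ : ∀ s → σ + W ≤ s → s < u → length (restrict i (H s)) ≤ budget (not ∘ φ) q p s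
      bud′ s le s<u with φ s in eq
      ... | true  = calm s i le (<-≤-trans s<u u≤t) eq
      ... | false = ≤-trans (length-restrict i (H s))
              (other-budget φ eq (bud s (≤-trans (m≤m+n σ W) le) (<-≤-trans s<u u≤t)))
      full : ∀ y → Active (not ∘ φ) (σ + W) y → C (σ + W) (sub i y)
      full y act′ with x , act , c ← seeded i =
        spread {C = below i C} i (alternating-not alt) (free-avoiding closed av) ≤-refl x y act c act′
          (begin
            depth y + (depth x + σ) ≡⟨ sym (+-assoc (depth y) (depth x) σ) ⟩
            depth y + depth x + σ   ≤⟨ +-monoˡ-≤ σ (+-mono-≤ (depth≤ y) (depth≤ x)) ⟩
            suc D + suc D + σ       ≤⟨ +-monoˡ-≤ σ wide ⟩
            W + σ                   ≡⟨ +-comm W σ ⟩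
            σ + W                   ∎)
        where open ≤-Reasoning

    root-contaminated : ∀ {σ t} → Seeded σ → Calm (σ + W) t → Budgeted σ t → σ + W ≤ t →
      φ t ≡ true → C t root
    root-contaminated {t = zero} seeded calm bud le φt =
      contradiction (≤-trans (≤-trans wide (m≤n+m W _)) le) λ ()
    root-contaminated {σ} {suc t} seeded calm bud le φt
      with i , av₁ , av₂ ← avoiding₂ {H = H} cap σ (σ ⊔ (suc t ∸ W))
      = closed child-contaminated (λ sub∈ → av₂ root (shots-∈ u W u≤t t<u+W sub∈)) (inj₂ top)
      where
      -- The second window ends at `suc t`, so it includes the shots of time `t` that could block
      -- the last move up. The maximum gives `σ ≤ u` at once, as `dirty` requires.
      u : ℕ
      u = σ ⊔ (suc t ∸ W)
      W≤t : W ≤ suc t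
      W≤t = ≤-trans (m≤n+m W σ) le
      -- `W` is at least `suc D + 1`: time to climb the child subtree, and one more step to the root
      -- above it.
      reserve : ∀ {v} → W + v ≤ suc t → suc D + v ≤ t
      reserve {v} h = s≤s⁻¹ (≤-trans (+-monoˡ-≤ v (≤-trans (s≤s (m≤n+m (suc D) D)) wide)) h)
      near : suc D + u ≤ t
      near = ≤-trans (≤-reflexive (+-distribˡ-⊔ (suc D) σ (suc t ∸ W)))
        (⊔-lub (reserve (≤-trans (≤-reflexive (+-comm W σ)) le))
               (reserve (≤-reflexive (m+[n∸m]≡n W≤t))))
      u≤t : u ≤ t
      u≤t = ≤-trans (m≤n+m u (suc D)) near
      t<u+W : t < u + W
      t<u+W = ≤-trans (≤-reflexive (sym (m∸n+n≡m W≤t))) (+-monoˡ-≤ W (m≤n⊔m σ (suc t ∸ W)))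
      free : Free (below i C) u (u + W)
      free = free-avoiding closed av₂
      φt′ : not (φ t) ≡ true
      φt′ = trans (sym (alt t)) φt
      child-contaminated : C t (sub i root)
      child-contaminated
        with x , act , c ← dirty seeded av₁ calm bud u (m≤m⊔n σ _) (m≤n⇒m≤1+n u≤t)
        = reach-root {C = below i C} i (alternating-not alt) free ≤-refl x act c φt′
            (≤-trans (+-monoˡ-≤ u (depth≤ x)) near) (<⇒≤ t<u+W)

    -- σ is the time just after the last reset.
    Progress : ℕ → ℕ → Set
    Progress t₀ t = ∃[ σ ] t₀ ≤ σ × σ ≤ t × Seeded σ × Calm (σ + W) t

    start : ∀ {t} → (∀ x → Active φ t x → C t x) → Progress t t
    start {t} full = t , ≤-refl , ≤-refl , seeded ,
      λ s i a≤s s<t _ → contradiction s<t (≤⇒≯ (≤-trans (m≤m+n t W) a≤s))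
      where
      seeded : Seeded t
      seeded i with φ t in eq
      ... | false = root , act , full _ act
        where
        act : Active φ t (sub i (root {D = suc D}))
        act = not-false eq
      -- When the class can occupy the root it contains no child of the root, so the seed is taken
      -- at depth two.
      ... | true = sub i root , act , full _ act
        where
        act : Active φ t (sub i (sub i (root {D = D})))
        act = trans (not-involutive (φ t)) eq

    -- A concentration of shots before `σ + W` is tolerated, since calm is only demanded from
    -- `σ + W` on; a later one produces a reset.
    advance : ∀ {t₀ t} → Progress t₀ t → Budgeted t₀ (suc t) → Progress t₀ (suc t)
    advance {t₀} {t} (σ , t₀≤σ , σ≤t , seeded , calm) bud
      with σ + W ≤? t | φ t in φt | any? (λ i → p <? length (restrict i (H t)))
    ... | yes le | true | yes (i , heavy) =
      suc t , ≤-trans t₀≤σ (m≤n⇒m≤1+n σ≤t) , ≤-refl ,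
      (λ j → root , act , closed c root∉ (inj₁ top)) ,
      λ s _ a≤s s<t _ → contradiction s<t (≤⇒≯ (≤-trans (m≤m+n (suc t) W) a≤s))
      where
      c : C t root
      c = root-contaminated seeded calm
            (λ s σ≤s s<t → bud s (≤-trans t₀≤σ σ≤s) (m≤n⇒m≤1+n s<t)) le φt
      -- With more than `p` shots inside subtree `i`, one more at the root would exceed the budget
      -- `suc p`.
      root∉ : root ∉ H t
      root∉ root∈ = contradiction
        (≤-trans (s≤s heavy) (≤-trans (length-restrict-root i root∈)
          (root-budget φ φt (bud t (≤-trans t₀≤σ σ≤t) ≤-refl))))
        (n≮n (suc p))
      act : not (φ (suc t)) ≡ true
      act = trans (cong not (alt t)) (trans (not-involutive (φ t)) φt)
    ... | no ≰ | _ | _ = σ , t₀≤σ , m≤n⇒m≤1+n σ≤t , seeded , calm′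
      where
      calm′ : Calm (σ + W) (suc t)
      calm′ s i a≤s s<t _ = contradiction (≤-trans a≤s (s≤s⁻¹ s<t)) ≰
    ... | yes _ | false | _ = σ , t₀≤σ , m≤n⇒m≤1+n σ≤t , seeded , calm′
      where
      calm′ : Calm (σ + W) (suc t)
      calm′ s i a≤s s<t φs with m≤n⇒m<n∨m≡n (s≤s⁻¹ s<t)
      ... | inj₁ s<t′ = calm s i a≤s s<t′ φs
      ... | inj₂ refl with trans (sym φt) φs
      ...   | ()
    ... | yes _ | true | no light = σ , t₀≤σ , m≤n⇒m≤1+n σ≤t , seeded , calm′
      where
      calm′ : Calm (σ + W) (suc t)
      calm′ s i a≤s s<t φs with m≤n⇒m<n∨m≡n (s≤s⁻¹ s<t)
      ... | inj₁ s<t′ = calm s i a≤s s<t′ φs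
      ... | inj₂ refl = ≮⇒≥ (λ heavy → light (i , heavy))

    progress : ∀ {t₀} → (∀ x → Active φ t₀ x → C t₀ x) → ∀ g → Budgeted t₀ (g + t₀) →
      Progress t₀ (g + t₀)
    progress full zero    _   = start full
    progress full (suc g) bud =
      advance (progress full g (λ s t₀≤s s<t → bud s t₀≤s (m≤n⇒m≤1+n s<t))) bud

    contaminated : ∀ {t₀ t} → Progress t₀ t → Budgeted t₀ t → ∃[ x ] Active φ t x × C t x
    contaminated (σ , t₀≤σ , σ≤t , seeded , calm) bud
      with i , av , _ ← avoiding₂ {H = H} cap σ σ
      with x , act , c ← dirty seeded av calm
             (λ s σ≤s s<t → bud s (≤-trans t₀≤σ σ≤s) s<t) _ σ≤t ≤-refl
      = sub i x , act , c

  module Unguarded {D q : ℕ} {φ : Phase} (0<W : 0 < W) (alt : Alternating φ)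
    {C : Family d (suc D)} {H : Shots d (suc D)}
    (closed : Closed C H) (cap : ∀ s → length (H s) ≤ K) where

    -- Invariant for `p = 0`: the root, unshot when active, contaminates all its children; these are
    -- too many to be all shot, so one of them contaminates the root again.
    Top : ℕ → Set
    Top t = (φ t ≡ true → C t root) × (φ t ≡ false → ∀ i → C t (sub i root))

    top-full : ∀ {t} → (∀ x → Active φ t x → C t x) → Top t
    top-full full = full root , λ φt i → full (sub i root) (not-false φt)

    top-suc : ∀ {t} → length (H t) ≤ budget φ 0 q t → Top t → Top (suc t)
    top-suc {t} bud (at-root , at-children) with φ t in φt
    ... | true = (λ φt′ → contradiction (trans (sym φt′) (trans (alt t) (cong not φt))) λ ()) ,
        λ _ i → closed (at-root refl) (root∉ bud) (inj₁ top)
      where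
      root∉ : ∀ {D} {xs : List (Tree d D)} → length xs ≤ 0 → root ∉ xs
      root∉ {xs = []} _ ()
    ... | false with i , av , _ ← avoiding₂ {H = H} cap t t
        = (λ _ → closed (at-children refl i)
            (λ sub∈ → av root (shots-∈ t W ≤-refl (m<m+n t 0<W) sub∈)) (inj₂ top)) ,
          λ φt′ → contradiction (trans (sym φt′) (trans (alt t) (cong not φt))) λ ()

    top-all : ∀ {t₀} → (∀ x → Active φ t₀ x → C t₀ x) → ∀ g →
      (∀ s → t₀ ≤ s → s < g + t₀ → length (H s) ≤ budget φ 0 q s) → Top (g + t₀)
    top-all full zero    _   = top-full full
    top-all {t₀} full (suc g) bud = top-suc (bud (g + t₀) (m≤n+m t₀ g) ≤-refl)
      (top-all full g (λ s t₀≤s s<t → bud s t₀≤s (m≤n⇒m≤1+n s<t)))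

    top-contaminated : ∀ {t} → Top t → ∃[ x ] Active φ t x × C t x
    top-contaminated {t} (at-root , at-children) with φ t in φt
    ... | true  = root , φt , at-root refl
    ... | false = sub some root , not-false φt , at-children refl some

  -- Passing to a child subtree lowers the height and the total budget by one each and swaps `p` and
  -- `q`, so the inequality persists until the first budget is zero.
  survival : ∀ D p q → p + q < D → D + D ≤ W → Survives D p q
  survival (suc D) zero q _ wide alt {C} {H} closed cap {t₀} t₀≤t bud full
    with g , refl ← m≤n⇒∃[o]o+m≡n t₀≤t
    = top-contaminated (top-all full g bud)
    where open Unguarded {q = q} (≤-trans (s≤s z≤n) wide) alt {C} {H} closed cap
  survival (suc zero) (suc p) q (s≤s ()) wide
  survival (suc (suc D)) (suc p) q (s≤s lt) wide alt {C} {H} closed cap {t₀} t₀≤t bud full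
    with g , refl ← m≤n⇒∃[o]o+m≡n t₀≤t
    = contaminated (progress full g bud) bud
    where
    wide′ : suc D + suc D ≤ W
    wide′ = ≤-trans (+-mono-≤ (n≤1+n (suc D)) (n≤1+n (suc D))) wide
    ih : Survives (suc D) q p
    ih = survival (suc D) q p (≤-<-trans (≤-reflexive (+-comm q p)) lt) wide′
    open Step {p = p} {q} wide′ ih alt {C} {H} closed cap

-- Compactness

lookup-unique : ∀ {a} {A : Set a} {xs : List A} → Unique xs → ∀ {i j} → lookup xs i ≡ lookup xs j → i ≡ j
lookup-unique (x∉ ∷ u) {zero}  {zero}  eq = refl
lookup-unique (x∉ ∷ u) {zero}  {suc j} eq = contradiction eq (All.lookup x∉ (∈-lookup j))
lookup-unique (x∉ ∷ u) {suc i} {zero}  eq = contradiction (sym eq) (All.lookup x∉ (∈-lookup i))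
lookup-unique (x∉ ∷ u) {suc i} {suc j} eq = cong suc (lookup-unique u eq)

length-unique : ∀ {n} {xs : List (Fin n)} → Unique xs → length xs ≤ n
length-unique u = injective⇒≤ (lookup-unique u)

module Fan {n} {E : Fin n → Fin n → Set} (E? : ∀ x y → Dec (E x y)) (serial : ∀ x → ∃ (E x)) where

  Safe : Set₁
  Safe = ℕ → Fin n → Set

  -- The territory of `v` at time `t`; safety is imposed at all times from 0 to `t` inclusive.
  Reach : Safe → Fin n → ℕ → Fin n → Set
  Reach A v zero    x = v ≡ x × A 0 x
  Reach A v (suc t) x = (∃[ y ] Reach A v t y × E y x) × A (suc t) x

  reach? : ∀ {A} → (∀ t x → Dec (A t x)) → ∀ v t x → Dec (Reach A v t x)
  reach? A? v zero    x = (v ≟ᶠ x) ×-dec A? 0 x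
  reach? A? v (suc t) x = any? (λ y → reach? A? v t y ×-dec E? y x) ×-dec A? (suc t) x

  reach-split : ∀ {A v} t {x} → Reach A v (suc t) x → ∃[ w ] E v w × Reach (A ∘ suc) w t x
  reach-split zero ((y , (refl , _) , e) , a) = _ , e , refl , a
  reach-split (suc t) ((y , r , e) , a) with w , e′ , r′ ← reach-split t r
    = w , e′ , (y , r′ , e) , a

  Dead : Safe → Fin n → ℕ → Set
  Dead A v t = ∀ x → ¬ Reach A v t x

  dead-+ : ∀ {A v t} s → Dead A v t → Dead A v (s + t)
  dead-+ zero    dead = dead
  dead-+ (suc s) dead x ((y , r , _) , _) = dead-+ s dead y r

  Dominated : Safe → ℕ → Fin n → Fin n → Set
  Dominated A t a c = ∀ x → Reach A a t x → Reach A c t x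

  dominated-+ : ∀ {A a c t} s → Dominated A t a c → Dominated A (s + t) a c
  dominated-+ zero    dom = dom
  dominated-+ (suc s) dom x ((y , r , e) , safe) = (y , dominated-+ s dom y r , e) , safe

  Width : Safe → ℕ → Set
  Width A m = ∀ t {xs} → Unique xs → All (A t) xs → length xs ≤ m

  Caught : Safe → Fin n → Set
  Caught A v = ∀ (r : ℕ → Fin n) → r 0 ≡ v → (∀ i → E (r i) (r (suc i))) → ∃[ i ] ¬ A i (r i)

  caught-suc : ∀ {A v w} → Caught A v → A 0 v → E v w → Caught (A ∘ suc) w
  caught-suc {A} {v} caught a e r refl walk = shift (caught r′ refl walk′)
    where
    r′ : ℕ → Fin n
    r′ zero    = v
    r′ (suc i) = r i
    walk′ : ∀ i → E (r′ i) (r′ (suc i))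
    walk′ zero    = e
    walk′ (suc i) = walk i
    shift : ∃[ i ] ¬ A i (r′ i) → ∃[ i ] ¬ A (suc i) (r i)
    shift (zero , ¬a)  = contradiction a ¬a
    shift (suc i , ¬a) = i , ¬a

  -- The walks that stay off the territory of c, as long as the latter is nonempty.
  _off_ : Safe → Fin n → Safe
  (A off c) t x = A t x × ∃ (Reach A c t) × ¬ Reach A c t x

  -- Safe moves do not leave a territory, so a walk that ends outside that of `c` was never inside
  -- it. A territory alive at some time was alive at all earlier ones.
  reach-off : ∀ {A a c} t {x} → Reach A a t x → ∃ (Reach A c t) → ¬ Reach A c t x → Reach (A off c) a t x
  reach-off zero (eq , safe) alive ¬r = eq , safe , alive , ¬r
  reach-off (suc t) ((y , r , e) , safe) alive@(_ , (z , r′ , _) , _) ¬r =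
    (y , reach-off t r (z , r′) (λ r″ → ¬r ((y , r″ , e) , safe)) , e) , safe , alive , ¬r

  off? : ∀ {A} c → (∀ t x → Dec (A t x)) → ∀ t x → Dec ((A off c) t x)
  off? c A? t x = A? t x ×-dec any? (reach? A? c t) ×-dec ¬? (reach? A? c t x)

  reach-safe : ∀ {A v} t {x} → Reach A v t x → A t x
  reach-safe zero    = proj₂
  reach-safe (suc t) = proj₂

  -- Any nonempty list of vertices allowed by `A off c` can be extended by one from the territory of
  -- `c`, whose nonemptiness is part of `A off c`.
  off-width : ∀ {A m} c → Width A (suc m) → Width (A off c) m
  off-width c width t {[]} u all = z≤n
  off-width c width t {x ∷ xs} u all@((_ , (y , r) , _) ∷ _) = s≤s⁻¹ (width t
    (All.map (λ { (_ , _ , ¬r) refl → ¬r r }) all ∷ u)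
    (reach-safe t r ∷ All.map proj₁ all))

  caught-off : ∀ {A v} c → Caught A v → Caught (A off c) v
  caught-off c caught r r0 walk with i , ¬a ← caught r r0 walk = i , ¬a ∘ proj₁

  Ending : ℕ → Set₁
  Ending m = ∀ {A} → (∀ t x → Dec (A t x)) → Width A m → ∀ v → Caught A v → ∃ (Dead A v)

  module Step {m : ℕ} (ih : Ending m) where

    -- Walks from a off the territory of c live in a safe set of smaller width, so by
    -- induction they die out, unless the territory of c does.
    compare : ∀ {A} → (∀ t x → Dec (A t x)) → Width A (suc m) → ∀ a c → Caught A a →
      ∃[ t ] Dominated A t a c ⊎ ∃[ t ] Dominated A t c a
    compare A? width a c caught
      with t , dead ← ih (off? c A?) (off-width c width) a (caught-off c caught)
      with any? (reach? A? c t)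
    ... | yes alive = inj₁ (t , λ x r →
            decidable-stable (reach? A? c t x) (dead x ∘ reach-off t r alive))
    ... | no ¬alive = inj₂ (t , λ x r → contradiction (x , r) ¬alive)

    record State : Set₁ where
      field
        {safe} : Safe
        safe?  : ∀ t x → Dec (safe t x)
        width  : Width safe (suc m)
        start  : Fin n
        caught : Caught safe start

    open State

    -- By `compare`, any two successors are eventually comparable. Scanning the list keeps the best
    -- one so far, and since domination persists, the time thresholds can be added.
    dominant : (st : State) → safe st 0 (start st) → ∀ xs → ∃[ c ] E (start st) c ×
      ∃[ t ] (∀ {a} → a ∈ xs → E (start st) a → Dominated (safe st ∘ suc) t a c)
    dominant st ok [] with c , e ← serial (start st) = c , e , 0 , λ ()
    dominant st ok (x ∷ xs) with c , e , t , dom ← dominant st ok xs with E? (start st) x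
    ... | no ¬e = c , e , t , λ where
            (here refl) e′ → contradiction e′ ¬e
            (there a∈)     → dom a∈
    ... | yes e′ with compare (safe? st ∘ suc) (width st ∘ suc) x c
                        (caught-suc {safe st} (caught st) ok e′)
    ...   | inj₁ (s , x≼c) = c , e , s + t , λ where
            (here refl) _ → subst (λ u → Dominated (safe st ∘ suc) u x c) (+-comm t s) (dominated-+ t x≼c)
            (there a∈) e″ → dominated-+ s (dom a∈ e″)
    ...   | inj₂ (s , c≼x) = x , e′ , s + t , λ where
            (here refl) _ → λ _ r → r
            (there a∈) e″ y → subst (λ u → Dominated (safe st ∘ suc) u c x)
                                    (+-comm t s) (dominated-+ t c≼x) y
                              ∘ dominated-+ s (dom a∈ e″) y

    next : (st : State) → safe st 0 (start st) → State
    next st ok with c , e , _ ← dominant st ok (allFin n) = record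
      { safe? = safe? st ∘ suc ; width = width st ∘ suc
      ; start = c ; caught = caught-suc {safe st} (caught st) ok e }

    wander : Fin n → ℕ → Fin n
    wander v zero    = v
    wander v (suc i) = wander (proj₁ (serial v)) i

    wander-walk : ∀ v i → E (wander v i) (wander v (suc i))
    wander-walk v zero    = proj₂ (serial v)
    wander-walk v (suc i) = wander-walk _ i

    -- Follows dominant successors while safe, then wanders anywhere, because `Caught` speaks of
    -- infinite walks.
    path : State → ℕ → Fin n
    path st zero    = start st
    path st (suc i) with safe? st 0 (start st)
    ... | yes ok = path (next st ok) i
    ... | no _   = wander (proj₁ (serial (start st))) i

    path-walk : ∀ st i → E (path st i) (path st (suc i))
    path-walk st zero with safe? st 0 (start st)
    ... | yes ok = proj₁ (proj₂ (dominant st ok (allFin n)))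
    ... | no _   = proj₂ (serial (start st))
    path-walk st (suc i) with safe? st 0 (start st)
    ... | yes ok = path-walk (next st ok) i
    ... | no _   = wander-walk _ i

    -- The moment at which this single walk is caught bounds all others: working backwards, if the
    -- dominant successor dies out, so do the successors it dominates, hence the start.
    path-dead : ∀ st i → ¬ safe st i (path st i) → ∃ (Dead (safe st) (start st))
    path-dead st zero    ¬ok = 0 , λ { x (refl , ok) → ¬ok ok }
    path-dead st (suc i) ¬ok with safe? st 0 (start st)
    ... | no ¬ok′ = 0 , λ { x (refl , ok) → ¬ok′ ok }
    ... | yes ok with t , dead ← path-dead (next st ok) i ¬ok
                with s , dom ← proj₂ (proj₂ (dominant st ok (allFin n)))
        = suc (t + s) , λ x r → let w , e , r′ = reach-split (t + s) r in
            subst (Dead _ _) (+-comm s t) (dead-+ s dead) x (dominated-+ t (dom (∈-allFin w) e) x r′)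

    state-dead : (st : State) → ∃ (Dead (safe st) (start st))
    state-dead st with i , ¬safe ← caught st (path st) refl (path-walk st) = path-dead st i ¬safe

  ending : ∀ m → Ending m
  ending zero A? width v caught = 0 , λ { x (_ , safe) → contradiction (width 0 ([] ∷ []) (safe ∷ [])) λ () }
  ending (suc m) A? width v caught = state-dead (record
    { safe? = A? ; width = width ; start = v ; caught = caught })
    where open Step (ending m)

  bounded : ∀ {A} → (∀ t x → Dec (A t x)) → (∀ v → Caught A v) → ∃[ t ] ∀ v → Dead A v t
  bounded {A} A? caught = let t , dead = common (allFin n) in t , λ v → dead (∈-allFin v)
    where
    common : ∀ vs → ∃[ t ] (∀ {v} → v ∈ vs → Dead A v t)
    common []       = 0 , λ ()
    common (v ∷ vs) with s , dead ← ending n A? (λ _ u _ → length-unique u) v (caught v)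
                    with t , deads ← common vs
      = s + t , λ where
          (here refl) → subst (Dead A v) (+-comm t s) (dead-+ t dead)
          (there v∈)  → dead-+ s (deads v∈)

-- The finite graph

child-depth : {x y : Tree d D} → Child x y → depth y ≡ suc (depth x)
child-depth top       = refl
child-depth (inner c) = cong suc (child-depth c)

parent-unique : {x y z : Tree d D} → Child x z → Child y z → x ≡ y
parent-unique top       top        = refl
parent-unique (inner c) (inner c′) = cong (sub _) (parent-unique c c′)

child? : (x y : Tree d D) → Dec (Child x y)
child? {D = zero}  root      root         = no λ ()
child? {D = suc D} root      root         = no λ ()
child? {D = suc D} (sub i x) root         = no λ ()
child? {D = suc D} root      (sub j root) = yes top
child? {D = suc D} root      (sub j (sub k y)) = no λ ()
child? {D = suc D} (sub i x) (sub j y) with i ≟ᶠ j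
... | no i≢j   = no λ { (inner _) → i≢j refl }
... | yes refl = map′ inner (λ { (inner c) → c }) (child? x y)

size : ℕ → ℕ → ℕ
size d zero    = 1
size d (suc D) = suc (d * size d D)

decode : ∀ D → Fin (size d D) → Tree d D
decode zero    _       = root
decode (suc D) zero    = root
decode {d} (suc D) (suc i) = let j , k = remQuot {d} (size d D) i in sub j (decode D k)

encode : Tree d D → Fin (size d D)
encode {D = zero}  root      = zero
encode {D = suc D} root      = zero
encode {D = suc D} (sub i x) = suc (combine i (encode x))

decode-encode : (x : Tree d D) → decode D (encode x) ≡ x
decode-encode {D = zero}  root = refl
decode-encode {D = suc D} root = refl
decode-encode {D = suc D} (sub i x) =
  trans (cong (λ (j , k) → sub j (decode D k)) (remQuot-combine i (encode x)))
        (cong (sub i) (decode-encode x))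

encode-decode : ∀ D (u : Fin (size d D)) → encode (decode D u) ≡ u
encode-decode zero    zero    = refl
encode-decode (suc D) zero    = refl
encode-decode {d} (suc D) (suc i) = cong suc
  (trans (cong (combine j) (encode-decode D k)) (combine-remQuot {d} (size d D) i))
  where
  j = proj₁ (remQuot {d} (size d D) i)
  k = proj₂ (remQuot {d} (size d D) i)

treeGraph : ∀ d D → Graph (size d D)
treeGraph d D = record
  { Adj    = λ u v → Adjacent (decode D u) (decode D v)
  ; sym    = swap
  ; irrefl = λ { (inj₁ c) → 1+n≢n (sym (child-depth c))
               ; (inj₂ c) → 1+n≢n (sym (child-depth c)) }
  }

adj-encode : {x y : Tree d D} → Adjacent x y → Adj (treeGraph d D) (encode x) (encode y)
adj-encode {x = x} {y} = subst₂ Adjacent (sym (decode-encode x)) (sym (decode-encode y))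

adj? : ∀ d D u v → Dec (Adj (treeGraph d D) u v)
adj? d D u v = child? (decode D u) (decode D v) ⊎-dec child? (decode D v) (decode D u)

snoc : ∀ {n} {G : Graph n} {u v w} → Walk G u v → Adj G v w → Walk G u w
snoc here       e = step e here
snoc (step e p) e′ = step e (snoc p e′)

connected : ∀ d D → Connected (treeGraph d D)
connected d D u v = subst (Walk _ u) (encode-decode D v)
  (descend {C = C} {e = e} free z≤n (decode D v) ≤-refl
    (climb {C = C} {s = 0} free z≤n x (m≤n+m _ (depth y))
      (subst (Walk _ u) (sym (encode-decode D u)) here)))
  where
  x = decode D u
  y = decode D v
  e : ℕ
  e = depth y + (depth x + 0)
  -- Reading contamination as reachability from `u`, constantly in time, turns `climb` and `descend`
  -- into a walk through the root.
  C : Family d D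
  C _ z = Walk (treeGraph d D) u (encode z)
  free : Free C 0 e
  free _ _ p adj = snoc p (adj-encode adj)

-- Acyclicity, by unique parents and depth.

module _ {d D : ℕ} where
  private
    G = treeGraph d D
    V = Fin (size d D)

    _◂_ : V → V → Set
    u ◂ v = Child (decode D u) (decode D v)

    rank : V → ℕ
    rank u = depth (decode D u)

    rank-< : ∀ {u v} → u ◂ v → rank u < rank v
    rank-< c = ≤-reflexive (sym (child-depth c))

    ◂-unique : ∀ {u v w} → u ◂ w → v ◂ w → u ≡ v
    ◂-unique {u} {v} c c′ =
      trans (sym (encode-decode D u)) (trans (cong encode (parent-unique c c′)) (encode-decode D v))

  last-∈ : ∀ {u v vs w} → PathList G u (v ∷ vs) w → w ∈ v ∷ vs
  last-∈ {vs = []}    (_ , refl) = here refl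
  last-∈ {vs = _ ∷ _} (_ , p)    = there (last-∈ p)

  -- A move up from `u` would return to its only parent `a`. So every move goes down, and the last
  -- one starts at the parent of `w`.
  descending : ∀ {a u v vs w} → a ◂ u → a ∉ v ∷ vs → Unique (u ∷ v ∷ vs) → PathList G u (v ∷ vs) w →
    rank u < rank w × ∃[ z ] z ∈ u ∷ v ∷ vs × z ◂ w
  descending a◂u a∉ _ (inj₂ v◂u , _) = contradiction (here (◂-unique a◂u v◂u)) a∉
  descending {vs = []} a◂u a∉ _ (inj₁ u◂v , refl) = rank-< u◂v , _ , here refl , u◂v
  descending {vs = _ ∷ _} a◂u a∉ ((_ ∷ u∉) ∷ uniq) (inj₁ u◂v , p)
    with lt , z , z∈ , z◂w ← descending u◂v (λ u∈ → All.lookup u∉ u∈ refl) uniq p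
    = <-trans (rank-< u◂v) lt , z , there z∈ , z◂w

  -- Without backtracking, a walk in a rooted tree that has gone down never goes up again.
  unimodal : ∀ {u v vs w} → Unique (u ∷ v ∷ vs) → PathList G u (v ∷ vs) w →
    rank w < rank u ⊎ ∃[ z ] z ∈ u ∷ v ∷ vs × z ◂ w
  unimodal {vs = []} _ (inj₁ u◂v , refl) = inj₂ (_ , here refl , u◂v)
  unimodal {vs = []} _ (inj₂ v◂u , refl) = inj₁ (rank-< v◂u)
  unimodal {vs = _ ∷ _} ((_ ∷ u∉) ∷ uniq) (inj₁ u◂v , p)
    with _ , z , z∈ , z◂w ← descending u◂v (λ u∈ → All.lookup u∉ u∈ refl) uniq p
    = inj₂ (z , there z∈ , z◂w)
  unimodal {vs = _ ∷ _} (_ ∷ uniq) (inj₂ v◂u , p) with unimodal uniq p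
  ... | inj₁ lt             = inj₁ (<-trans lt (rank-< v◂u))
  ... | inj₂ (z , z∈ , z◂w) = inj₂ (z , there z∈ , z◂w)

  -- Cases on the two edges at `v₀`. If both go up, `v₁` and `w` coincide; otherwise the depths
  -- conflict, or the parent of `w` found on the path is `v₀`, which is then repeated.
  acyclic : ¬ HasCycle G
  acyclic (_ , [] , _ , () , _)
  acyclic (_ , _ ∷ [] , _ , s≤s () , _)
  acyclic (v₀ , v₁ ∷ v₂ ∷ vs , w , _ , (v₀∉ ∷ uniq@(v₁∉ ∷ _)) , (first , p) , last) = cases first last
    where
    v₁≢w : v₁ ≢ w
    v₁≢w = All.lookup v₁∉ (last-∈ p)
    not-v₀ : ∀ {z} → z ∈ v₁ ∷ v₂ ∷ vs → z ◂ w → ¬ v₀ ◂ w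
    not-v₀ z∈ z◂w v₀◂w = All.lookup v₀∉ z∈ (◂-unique v₀◂w z◂w)
    cases : Adj G v₀ v₁ → Adj G w v₀ → _
    cases (inj₂ v₁◂v₀) (inj₁ w◂v₀) = contradiction (◂-unique v₁◂v₀ w◂v₀) v₁≢w
    cases (inj₂ v₁◂v₀) (inj₂ v₀◂w) with unimodal uniq p
    ... | inj₁ lt             = contradiction (<-trans lt (rank-< v₁◂v₀)) (<⇒≯ (rank-< v₀◂w))
    ... | inj₂ (z , z∈ , z◂w) = contradiction v₀◂w (not-v₀ z∈ z◂w)
    cases (inj₁ v₀◂v₁) last
      with lt , z , z∈ , z◂w ← descending v₀◂v₁ (λ v₀∈ → All.lookup v₀∉ (there v₀∈) refl) uniq p
      with last
    ... | inj₁ w◂v₀ = contradiction (<-trans (rank-< v₀◂v₁) lt) (<⇒≯ (rank-< w◂v₀))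
    ... | inj₂ v₀◂w = contradiction v₀◂w (not-v₀ z∈ z◂w)

isTree : ∀ d D → IsTree (treeGraph d D)
isTree d D = nonempty D , connected d D , acyclic
  where
  nonempty : ∀ D → 1 ≤ size d D
  nonempty zero    = s≤s z≤n
  nonempty (suc _) = s≤s z≤n

-- Escape from the hunters on the finite graph.

elements : ∀ {n} → Subset n → List (Fin n)
elements []          = []
elements (true ∷ p)  = zero ∷ map suc (elements p)
elements (false ∷ p) = map suc (elements p)

length-elements : ∀ {n} (p : Subset n) → length (elements p) ≡ ∣ p ∣
length-elements []          = refl
length-elements (true ∷ p)  = cong suc (trans (length-map suc (elements p)) (length-elements p))
length-elements (false ∷ p) = trans (length-map suc (elements p)) (length-elements p)

∈-elements : ∀ {n} {p : Subset n} {x} → x ∈ˢ p → x ∈ elements p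
∈-elements {p = true ∷ p}  {zero}  _ = here refl
∈-elements {p = true ∷ p}  {suc x} (there x∈) = there (∈-map⁺ suc (∈-elements x∈))
∈-elements {p = false ∷ p} {suc x} (there x∈) = ∈-map⁺ suc (∈-elements x∈)

even : ℕ → Bool
even zero    = true
even (suc n) = not (even n)

module Escape (K : ℕ) where

  -- The height is the least above `K + K`, the sum of the two budgets; the degree is the least
  -- allowed by `room`.
  height window degree : ℕ
  height = suc (K + K)
  window = height + height
  degree = suc (window * K + window * K)

  open Survival degree K window ≤-refl

  G : Graph (size degree height)
  G = treeGraph degree height

  serial : ∀ u → ∃ (Adj G u)
  serial u with y , adj , _ ← neighbour zero (decode height u)
    = encode y , subst (Adjacent (decode height u)) (sym (decode-encode y)) adj

  open Fan (adj? degree height) serial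

  -- Winning hunters would catch all walks by a uniform time `t`, whereas `survival` at time `suc t`
  -- yields a walk uncaught after the shots of time `t`.
  hunters-lose : ∀ j → j ≤ K → ¬ HuntersWin G j
  hunters-lose j j≤K ((H , small) , win) = dead v y reached
    where
    safe : Safe
    safe s u = ¬ u ∈ˢ H s

    death = bounded {A = safe} (λ s u → ¬? (u ∈ˢ? H s))
      (λ v r _ walk → let i , caught = win r walk in i , λ escaped → escaped caught)
    t = proj₁ death
    dead = proj₂ death

    -- `C` is taken before the shots and `Reach` after them, whence the shift by one step.
    C : Family degree height
    C zero    x = ⊤
    C (suc s) x = ∃[ v ] ∃[ y ] Reach safe v s y × Adj G y (encode x)

    H′ : Shots degree height
    H′ s = map (decode height) (elements (H s))

    safe-encode : ∀ {s x} → x ∉ H′ s → safe s (encode x)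
    safe-encode {s} {x} x∉ x∈ =
      x∉ (subst (_∈ H′ s) (decode-encode x) (∈-map⁺ (decode height) (∈-elements x∈)))

    closed : Closed C H′
    closed {zero}  _                  x∉ adj = _ , _ , (refl , safe-encode x∉) , adj-encode adj
    closed {suc s} (v , y , r , adj) x∉ adj′ = v , _ , ((y , r , adj) , safe-encode x∉) , adj-encode adj′

    cap : ∀ s → length (H′ s) ≤ K
    cap s = ≤-trans (≤-reflexive (trans (length-map (decode height) (elements (H s))) (length-elements (H s))))
      (≤-trans (small s) j≤K)

    within-budget : ∀ s → length (H′ s) ≤ budget even K K s
    within-budget s with even s
    ... | true  = cap s
    ... | false = cap s

    survivor : ∃[ x ] Active even (suc t) x × C (suc t) x
    survivor = survival height K K ≤-refl ≤-refl (λ _ → refl) {C} {H′} closed cap {0} z≤n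
      (λ s _ _ → within-budget s) (λ _ _ → tt)

    v = proj₁ (proj₂ (proj₂ survivor))
    y = proj₁ (proj₂ (proj₂ (proj₂ survivor)))
    reached = proj₁ (proj₂ (proj₂ (proj₂ (proj₂ survivor))))

-- Bounding the number of vertices.

size-≤ : ∀ d D → size d D ≤ suc d ^ D
size-≤ d zero    = ≤-refl
size-≤ d (suc D) = +-mono-≤ (m^n>0 (suc d) D) (*-monoʳ-≤ d (size-≤ d D))

n<2^[1+⌊log₂n⌋] : ∀ n → n < 2 ^ suc ⌊log₂ n ⌋
n<2^[1+⌊log₂n⌋] n = ≰⇒> λ le →
  n≮n _ (≤-trans (≤-reflexive (sym (⌊log₂[2^n]⌋≡n (suc ⌊log₂ n ⌋)))) (⌊log₂⌋-mono-≤ le))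

size-bound : ∀ K → 1 ≤ K → let open Escape K in size degree height ≤ 2 ^ (14 * suc K * ⌊log₂ suc K ⌋)
size-bound K 1≤K = begin
  size degree height     ≤⟨ size-≤ degree height ⟩
  suc degree ^ height    ≤⟨ ^-monoˡ-≤ height degree-bound ⟩
  (2 ^ (7 * l)) ^ height ≡⟨ ^-*-assoc 2 (7 * l) height ⟩
  2 ^ (7 * l * height)   ≤⟨ ^-monoʳ-≤ 2 exponent ⟩
  2 ^ (14 * k * l)       ∎
  where
  open Escape K
  open ≤-Reasoning
  open +-*-Solver
  k l : ℕ
  k = suc K
  l = ⌊log₂ k ⌋
  1≤l : 1 ≤ l
  1≤l = ≤-trans (≤-reflexive (sym (⌊log₂[2^n]⌋≡n 1))) (⌊log₂⌋-mono-≤ (s≤s 1≤K))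
  k≤2^[1+l] : k ≤ 2 ^ suc l
  k≤2^[1+l] = <⇒≤ (n<2^[1+⌊log₂n⌋] k)
  -- The added term completes `suc degree` to `8 * (k * k)`, which is at most 2 to the power
  -- `5 + 2 * l`; the factor 7 then comes from `1 ≤ l`.
  degree-bound : suc degree ≤ 2 ^ (7 * l)
  degree-bound = begin
    suc degree                  ≤⟨ m≤m+n (suc degree) (12 * K + 6) ⟩
    suc degree + (12 * K + 6)   ≡⟨ solve 1 (λ K → let D = con 1 :+ (K :+ K) ; W = D :+ D in
                                     con 2 :+ (W :* K :+ W :* K) :+ (con 12 :* K :+ con 6) :=
                                     con 8 :* ((con 1 :+ K) :* (con 1 :+ K))) refl K ⟩
    8 * (k * k)                 ≤⟨ *-monoʳ-≤ 8 (*-mono-≤ k≤2^[1+l] k≤2^[1+l]) ⟩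
    8 * (2 ^ suc l * 2 ^ suc l) ≡⟨ cong (8 *_) (sym (^-distribˡ-+-* 2 (suc l) (suc l))) ⟩
    2 ^ 3 * 2 ^ (suc l + suc l) ≡⟨ sym (^-distribˡ-+-* 2 3 (suc l + suc l)) ⟩
    2 ^ (3 + (suc l + suc l))   ≤⟨ ^-monoʳ-≤ 2 (begin
      3 + (suc l + suc l)         ≡⟨ solve 1 (λ l → con 3 :+ (con 1 :+ l :+ (con 1 :+ l)) :=
                                      con 5 :* con 1 :+ con 2 :* l) refl l ⟩
      5 * 1 + 2 * l               ≤⟨ +-monoˡ-≤ (2 * l) (*-monoʳ-≤ 5 1≤l) ⟩
      5 * l + 2 * l               ≡⟨ sym (*-distribʳ-+ l 5 2) ⟩
      7 * l                       ∎) ⟩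
    2 ^ (7 * l)                 ∎
  -- `suc height` is `2 * k`, which turns 7 into 14.
  exponent : 7 * l * height ≤ 14 * k * l
  exponent = begin
    7 * l * height     ≤⟨ *-monoʳ-≤ (7 * l) (m≤n+m height 1) ⟩
    7 * l * suc height ≡⟨ solve 2 (λ l K → con 7 :* l :* (con 2 :+ (K :+ K)) :=
                            con 14 :* (con 1 :+ K) :* l) refl l K ⟩
    14 * k * l         ∎

theorem14 : Σ ℕ λ C → (k : ℕ) → 1 ≤ k →
    Σ ℕ λ n → Σ (Graph n) λ T →
    IsTree T × HunterNumber≥ T k × (2 ≤ k → n ≤ 2 ^ (C * k * ⌊log₂ k ⌋))
theorem14 = 14 , λ where
  (suc K) _ → let open Escape K in
    size degree height , G , isTree degree height ,
    (λ j j<k → hunters-lose j (s≤s⁻¹ j<k)) , size-bound K ∘ s≤s⁻¹
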